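{- Let $0<m\le M$ and $\varphi=\frac{M}{m}$. Consider the energy storage problem $({\sf ESP})$ with abundant excessive renewable energy, i.e. $\rho\ge 1$. Then the competitive ratio of any deterministic online algorithm ${\cal A}$ satisfies $${\sf CR}({\cal A})\ge\varphi.$$
   Context: Energy storage problem $({\sf ESP})$. Time slots are $t=1,\dots,T$. The system has given parameters: storage capacity $B$; charging efficiency $\eta_{\rm c}\le 1$ and discharging efficiency $\eta_{\rm d}\ge 1$; charging and discharging rate limits $\mu_{\rm c},\mu_{\rm d}$; initial and terminal levels $B_{\rm s},B_{\rm e}$. The input is $\sigma=(a(t),p(t),r(t))_{t=1}^T$, where $a(t)\ge 0$ is the (excessive) demand, $r(t)\ge 0$ is the (free) excessive renewable energy, and $p(t)$ is the market price with $m\le p(t)\le M$. Minimize $\sum_{t=1}^T p(t)\big(v_{\rm a}(t)+v_{\rm b}(t)\big)$ over nonnegative $x(t),d(t),r_{\rm b}(t),v_{\rm a}(t),v_{\rm b}(t)$ subject to, for all $t$: - $x(t)=x(t-1)+\eta_{\rm c}(r_{\rm b}(t)+v_{\rm b}(t))-\eta_{\rm d}d(t)$; - $d(t)+v_{\rm a}(t)=a(t)$; - $r_{\rm b}(t)\le r(t)$; - $0\le x(t)\le B$; - $r_{\rm b}(t)+v_{\rm b}(t)\le\mu_{\rm c}$ and $d(t)\le\mu_{\rm d}$; - boundary conditions $x(0)=B_{\rm s}$, $x(T)=B_{\rm e}$. The normalized renewable ratio is $\rho=\frac{\eta_{\rm c}}{\eta_{\rm d}}\cdot\frac{\sum_{t=1}^T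 r(t)}{\sum_{t=1}^T a(t)}$. Online algorithms and competitive ratio. An algorithm is online if its decision at the current slot $t$ depends only on $(a(\tau),p(\tau),r(\tau))_{\tau\le t}$. ${\sf Cost}({\cal A}[\sigma])$ is the cost of algorithm ${\cal A}$ on input $\sigma$, and ${\sf Opt}(\sigma)$ is the cost of an offline optimal solution (all of $\sigma$ known in advance). The competitive ratio is the worst-case ratio over inputs, ${\sf CR}({\cal A})=\max_\sigma\frac{{\sf Cost}({\cal A}[\sigma])}{{\sf Opt}(\sigma)}$, where $\sigma$ ranges over the inputs $(a(t),p(t),r(t))_{t=1}^T$ (here those with $\rho\ge1$); the ratio is regarded as unbounded when ${\sf Opt}(\sigma)=0<{\sf Cost}({\cal A}[\sigma])$. -}

module Defs where

open import Level using (suc; _⊔_)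
open import Algebra.Core using (Op₁; Op₂)
open import Algebra.Bundles using (CommutativeRing)
open import Algebra.Structures using (IsCommutativeRing)
import Algebra.Definitions.RawMonoid as RawMonoidOps
open import Data.Nat.Base as ℕ using (ℕ)
open import Data.Fin.Base as Fin using (Fin; inject₁; fromℕ)
open import Data.Product.Base using (_×_; Σ-syntax; ∃-syntax)
open import Data.Sum.Base using (_⊎_)
open import Relation.Nullary.Negation using (¬_)
open import Relation.Binary.Core using (Rel)
open import Relation.Binary.Structures using (IsDecTotalOrder)
import Relation.Binary.Construct.NonStrictToStrict as NonStrictToStrict

-- Stands in for the real numbers, which the standard library lacks: ℚ is an
-- instance, and so, classically, is ℝ (decidability of the order is then
-- excluded middle).  The inverse is total; its value at 0# is unconstrained.
record ArchimedeanOrderedField c ℓ₁ ℓ₂ : Set (suc (c ⊔ ℓ₁ ⊔ ℓ₂)) where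
  infix  8 -_
  infix  9 _⁻¹
  infixl 7 _*_ _/_
  infixl 6 _+_ _-_
  infix  4 _≈_ _≤_
  field
    Carrier           : Set c
    _≈_               : Rel Carrier ℓ₁
    _≤_               : Rel Carrier ℓ₂
    _+_ _*_           : Op₂ Carrier
    -_ _⁻¹            : Op₁ Carrier
    0# 1#             : Carrier
    isCommutativeRing : IsCommutativeRing _≈_ _+_ _*_ -_ 0# 1#
    isDecTotalOrder   : IsDecTotalOrder _≈_ _≤_
    0≉1               : ¬ (0# ≈ 1#)
    ⁻¹-cong           : ∀ {x y} → x ≈ y → x ⁻¹ ≈ y ⁻¹
    *-inverseʳ        : ∀ x → ¬ (x ≈ 0#) → x * x ⁻¹ ≈ 1#
    +-monoˡ-≤         : ∀ z {x y} → x ≤ y → x + z ≤ y + z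
    *-nonNeg          : ∀ {x y} → 0# ≤ x → 0# ≤ y → 0# ≤ x * y

  commutativeRing : CommutativeRing c ℓ₁
  commutativeRing = record { isCommutativeRing = isCommutativeRing }

  open RawMonoidOps (CommutativeRing.+-rawMonoid commutativeRing) public
    using (sum) renaming (_×_ to _·_)

  field
    archimedean : ∀ x → ∃[ n ] x ≤ n · 1#

  open NonStrictToStrict _≈_ _≤_ public using (_<_)

  _-_ _/_ : Op₂ Carrier
  x - y = x + - y
  x / y = x * y ⁻¹

module EnergyStorage {c ℓ₁ ℓ₂} (F : ArchimedeanOrderedField c ℓ₁ ℓ₂) where

  open ArchimedeanOrderedField F

  -- The bounds exclude a system without usable storage: if B ≈ 0#, say, then
  -- the slots decouple and choosing the best decision slot by slot is optimal.
  record System : Set (c ⊔ ℓ₁ ⊔ ℓ₂) where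
    field
      B ηc ηd μc μd Bs Be : Carrier
      0<B   : 0# < B
      0<ηc  : 0# < ηc
      ηc≤1  : ηc ≤ 1#
      1≤ηd  : 1# ≤ ηd
      0<μc  : 0# < μc
      0<μd  : 0# < μd
      0≤Bs  : 0# ≤ Bs
      Bs≤B  : Bs ≤ B
      0≤Be  : 0# ≤ Be
      Be≤B  : Be ≤ B

  -- Index i : Fin T is time slot i + 1.
  record Input (T : ℕ) : Set c where
    field
      a p r : Fin T → Carrier

  -- x is indexed by 0, …, T; the level at the end of slot i is x (suc i).
  record Schedule (T : ℕ) : Set c where
    field
      x             : Fin (ℕ.suc T) → Carrier
      d rb va vb    : Fin T → Carrier

  -- Bounds on each slot, and a positive total demand so that ρ makes sense.
  record Admissible (m M : Carrier) {T : ℕ} (σ : Input T) : Set (ℓ₁ ⊔ ℓ₂) where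
    open Input σ
    field
      0≤a  : ∀ t → 0# ≤ a t
      0≤r  : ∀ t → 0# ≤ r t
      m≤p  : ∀ t → m ≤ p t
      p≤M  : ∀ t → p t ≤ M
      0<Σa : 0# < sum a

  ρ : System → {T : ℕ} → Input T → Carrier
  ρ S σ = (ηc / ηd) * (sum r / sum a)
    where
    open System S
    open Input σ

  AbundantInput : System → (m M : Carrier) {T : ℕ} → Input T → Set (ℓ₁ ⊔ ℓ₂)
  AbundantInput S m M σ = Admissible m M σ × 1# ≤ ρ S σ

  record Feasible (S : System) {T : ℕ} (σ : Input T) (s : Schedule T)
         : Set (ℓ₁ ⊔ ℓ₂) where
    open System S
    open Input σ
    open Schedule s
    field
      dynamics   : ∀ t → x (Fin.suc t) ≈
                         x (inject₁ t) + ηc * (rb t + vb t) - ηd * d t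
      demand     : ∀ t → d t + va t ≈ a t
      renewable  : ∀ t → rb t ≤ r t
      0≤x        : ∀ t → 0# ≤ x t
      x≤B        : ∀ t → x t ≤ B
      charge     : ∀ t → rb t + vb t ≤ μc
      discharge  : ∀ t → d t ≤ μd
      initial    : x Fin.zero ≈ Bs
      terminal   : x (fromℕ T) ≈ Be
      0≤d        : ∀ t → 0# ≤ d t
      0≤rb       : ∀ t → 0# ≤ rb t
      0≤va       : ∀ t → 0# ≤ va t
      0≤vb       : ∀ t → 0# ≤ vb t

  cost : {T : ℕ} → Input T → Schedule T → Carrier
  cost σ s = sum λ t → p t * (va t + vb t)
    where
    open Input σ
    open Schedule s

  Optimal : System → {T : ℕ} → Input T → Schedule T → Set (c ⊔ ℓ₁ ⊔ ℓ₂)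
  Optimal S σ s = Feasible S σ s × (∀ s′ → Feasible S σ s′ → cost σ s ≤ cost σ s′)

  -- The algorithm may know the horizon T in advance.
  Algorithm : Set c
  Algorithm = ∀ {T} → Input T → Schedule T

  AgreeUpTo : {T : ℕ} → Fin T → Input T → Input T → Set ℓ₁
  AgreeUpTo t σ σ′ = ∀ τ → τ Fin.≤ t →
      Input.a σ τ ≈ Input.a σ′ τ
    × Input.p σ τ ≈ Input.p σ′ τ
    × Input.r σ τ ≈ Input.r σ′ τ

  SameDecision : {T : ℕ} → Fin T → Schedule T → Schedule T → Set ℓ₁
  SameDecision t s s′ =
      Schedule.x  s (Fin.suc t) ≈ Schedule.x s′ (Fin.suc t)
    × Schedule.d  s t ≈ Schedule.d  s′ t
    × Schedule.rb s t ≈ Schedule.rb s′ t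
    × Schedule.va s t ≈ Schedule.va s′ t
    × Schedule.vb s t ≈ Schedule.vb s′ t

  Online : Algorithm → Set (c ⊔ ℓ₁)
  Online A = ∀ {T} (t : Fin T) (σ σ′ : Input T) →
    AgreeUpTo t σ σ′ → SameDecision t (A σ) (A σ′)

  -- The algorithm solves every instance with ρ ≥ 1 that has a solution at all.
  Solves : System → (m M : Carrier) → Algorithm → Set (c ⊔ ℓ₁ ⊔ ℓ₂)
  Solves S m M A = ∀ {T} (σ : Input T) → AbundantInput S m M σ →
    (∃[ s ] Feasible S σ s) → Feasible S σ (A σ)

  -- θ ≤ k / o, where the ratio is unbounded for o ≈ 0# < k and the
  -- indeterminate 0 / 0 does not count.
  RatioAtLeast : (θ k o : Carrier) → Set (ℓ₁ ⊔ ℓ₂)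
  RatioAtLeast θ k o = (0# < o × θ ≤ k / o) ⊎ (o ≈ 0# × 0# < k)

  -- CR(A) ≥ θ, for CR(A) the maximum of cost (A σ) / Opt(σ) over all inputs σ
  -- with ρ ≥ 1, of any length T.
  CR[_,_,_,_]≥_ : System → (m M : Carrier) → Algorithm → Carrier → Set (c ⊔ ℓ₁ ⊔ ℓ₂)
  CR[ S , m , M , A ]≥ θ =
    ∃[ T ] Σ[ σ ∈ Input T ] Σ[ opt ∈ Schedule T ]
      AbundantInput S m M σ × Optimal S σ opt ×
      RatioAtLeast θ (cost σ (A σ)) (cost σ opt)

{-# OPTIONS --safe #-}

-- The price is m except in one "crunch" slot, where it is M.  In each of the n
-- early slots the demand is δ, and the renewable energy is such that the storage
-- level moves from Bs to a low level E over these slots if nothing is ever bought.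
-- In the crunch slot the demand is γ ∈ {0, δ} and there is no renewable energy;
-- one last slot has abundant renewable energy and no demand, which makes ρ ≥ 1
-- and lifts the level from E to Be.  E is as low as that last slot permits, so an
-- energy balance forces at least γ to be bought up to and including the crunch
-- slot, and m γ, reached by buying γ / n in every early slot, is the optimal cost.
-- An online algorithm cannot tell γ = 0 from γ = δ before the crunch.  If for
-- γ = δ it buys anything early, then for γ = 0 it has a positive cost while the
-- optimum is 0; otherwise it pays at least M δ for γ = δ, where the optimum is m δ.

module Submission where

open import Defs

open import Algebra.Bundles using (CommutativeRing; RawRing)
open import Data.Fin.Base as Fin using (Fin; zero; suc; inject₁; fromℕ)
open import Data.Maybe.Base as Maybe using (Maybe)
open import Data.Nat.Base as ℕ using (ℕ; zero; suc)
import Data.Nat.Properties as ℕₚ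
open import Data.Product.Base using (_×_; _,_; proj₁; proj₂; ∃-syntax)
open import Data.Sum.Base using (inj₁; inj₂)
open import Data.Empty using (⊥-elim)
import Level
open import Function.Base using (_∘_)
open import Relation.Nullary using (¬_; yes; no)
open import Relation.Nullary.Decidable.Core using (dec⇒maybe)
open import Relation.Binary.Structures using (IsDecTotalOrder)
open import Relation.Binary.PropositionalEquality.Core as ≡ using (_≡_)

-- The ring solver with formal differences of naturals as coefficients: over an
-- abstract ring, coefficients from the ring itself do not compute, so that the
-- solver would not cancel x - x.
module IntegerCoefficients {c ℓ} (R : CommutativeRing c ℓ) where

  open CommutativeRing R
  open import Algebra.Properties.Ring ring using (-0#≈0#; -‿distribˡ-*; -‿distribʳ-*)
  open import Algebra.Properties.AbelianGroup +-abelianGroup using (⁻¹-∙-comm; ⁻¹-involutive; ⁻¹-anti-homo‿-)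
  open import Algebra.Properties.Semiring.Mult semiring using ()
    renaming (_×_ to _·_; ×-homo-+ to ·-homo-+; ×1-homo-* to ·1-homo-*)
  open import Algebra.Properties.Semiring.Mult.TCOptimised semiring using ()
    renaming (_×_ to _·′_; ×ᵤ≈× to ·≈·′)
  open import Algebra.Solver.Ring.AlmostCommutativeRing using (fromCommutativeRing; _-Raw-AlmostCommutative⟶_)
  open import Algebra.Solver.Ring.NaturalCoefficients.Default commutativeSemiring as ℕ-Solver using ()
    renaming (_:+_ to _⊕_; _:*_ to _⊗_; _:=_ to _⊜_)
  open import Relation.Binary.Reasoning.Setoid setoid

  -- Keeps coefficients canonical, since the solver compares normal forms by refl.
  reduce : ℕ → ℕ → ℕ × ℕ
  reduce a b = a ℕ.∸ b , b ℕ.∸ a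

  differenceRing : RawRing _ _
  differenceRing = record
    { Carrier = ℕ × ℕ
    ; _≈_     = _≡_
    ; _+_     = λ (a , b) (c , d) → reduce (a ℕ.+ c) (b ℕ.+ d)
    ; _*_     = λ (a , b) (c , d) → reduce (a ℕ.* c ℕ.+ b ℕ.* d) (a ℕ.* d ℕ.+ b ℕ.* c)
    ; -_      = λ (a , b) → b , a
    ; 0#      = 0 , 0
    ; 1#      = 1 , 0
    }

  -- The two cases make ⟦ 0 , 0 ⟧ and ⟦ 1 , 0 ⟧ reduce to 0# and 1#.
  ⟦_⟧ : ℕ × ℕ → Carrier
  ⟦ a , zero  ⟧ = a ·′ 1#
  ⟦ a , suc b ⟧ = a ·′ 1# - suc b ·′ 1#

  ⟦⟧≈ : ∀ a b → ⟦ a , b ⟧ ≈ a · 1# - b · 1#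
  ⟦⟧≈ a zero    = begin
    a ·′ 1#       ≈⟨ ·≈·′ a 1# ⟨
    a · 1#        ≈⟨ +-identityʳ _ ⟨
    a · 1# + 0#   ≈⟨ +-congˡ -0#≈0# ⟨
    a · 1# - 0#   ∎
  ⟦⟧≈ a (suc b) = sym (+-cong (·≈·′ a 1#) (-‿cong (·≈·′ (suc b) 1#)))

  -- The hypothesis says that both pairs denote the same integer. Inserting `D - D` lets it be used
  -- in this additive form, free of truncated subtraction.
  ⟦⟧-cong : ∀ a b c d → a ℕ.+ d ≡ c ℕ.+ b → ⟦ a , b ⟧ ≈ ⟦ c , d ⟧
  ⟦⟧-cong a b c d eq = begin
    ⟦ a , b ⟧                           ≈⟨ ⟦⟧≈ a b ⟩
    A - B                               ≈⟨ +-identityʳ _ ⟨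
    A - B + 0#                          ≈⟨ +-congˡ (-‿inverseʳ D) ⟨
    A - B + (D - D)                     ≈⟨ swap A (- B) D (- D) ⟩
    A + D + (- B - D)                   ≈⟨ +-congʳ A+D≈C+B ⟩
    C + B + (- B - D)                   ≈⟨ regroup C B (- B) (- D) ⟩
    C - D + (B - B)                     ≈⟨ +-congˡ (-‿inverseʳ B) ⟩
    C - D + 0#                          ≈⟨ +-identityʳ _ ⟩
    C - D                               ≈⟨ ⟦⟧≈ c d ⟨
    ⟦ c , d ⟧                           ∎
    where
    A = a · 1#
    B = b · 1#
    C = c · 1#
    D = d · 1#
    A+D≈C+B : A + D ≈ C + B
    A+D≈C+B = begin
      A + D           ≈⟨ ·-homo-+ 1# a d ⟨
      (a ℕ.+ d) · 1#  ≡⟨ ≡.cong (_· 1#) eq ⟩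
      (c ℕ.+ b) · 1#  ≈⟨ ·-homo-+ 1# c b ⟩
      C + B           ∎
    swap : ∀ x y z w → x + y + (z + w) ≈ x + z + (y + w)
    swap = ℕ-Solver.solve 4 (λ x y z w → (x ⊕ y) ⊕ (z ⊕ w) ⊜ (x ⊕ z) ⊕ (y ⊕ w)) refl
    regroup : ∀ x y z w → x + y + (z + w) ≈ x + w + (y + z)
    regroup = ℕ-Solver.solve 4 (λ x y z w → (x ⊕ y) ⊕ (z ⊕ w) ⊜ (x ⊕ w) ⊕ (y ⊕ z)) refl

  -- Both sides are the maximum of `m` and `n`. This is why `reduce` keeps the integer that a pair
  -- denotes.
  m∸n+n≡m+n∸m : ∀ m n → m ℕ.∸ n ℕ.+ n ≡ m ℕ.+ (n ℕ.∸ m)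
  m∸n+n≡m+n∸m zero    zero    = ≡.refl
  m∸n+n≡m+n∸m zero    (suc n) = ≡.refl
  m∸n+n≡m+n∸m (suc m) zero    = ≡.refl
  m∸n+n≡m+n∸m (suc m) (suc n) = ≡.trans (ℕₚ.+-suc (m ℕ.∸ n) n) (≡.cong suc (m∸n+n≡m+n∸m m n))

  ⟦⟧-reduce : ∀ a b → ⟦ reduce a b ⟧ ≈ ⟦ a , b ⟧
  ⟦⟧-reduce a b = ⟦⟧-cong (a ℕ.∸ b) (b ℕ.∸ a) a b (m∸n+n≡m+n∸m a b)

  -‿homo : ∀ a b → ⟦ b , a ⟧ ≈ - ⟦ a , b ⟧
  -‿homo a b = begin
    ⟦ b , a ⟧           ≈⟨ ⟦⟧≈ b a ⟩
    b · 1# - a · 1#     ≈⟨ ⁻¹-anti-homo‿- (a · 1#) (b · 1#) ⟨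
    - (a · 1# - b · 1#) ≈⟨ -‿cong (⟦⟧≈ a b) ⟨
    - ⟦ a , b ⟧         ∎

  +-homo : ∀ a b c d → ⟦ a ℕ.+ c , b ℕ.+ d ⟧ ≈ ⟦ a , b ⟧ + ⟦ c , d ⟧
  +-homo a b c d = begin
    ⟦ a ℕ.+ c , b ℕ.+ d ⟧                   ≈⟨ ⟦⟧≈ (a ℕ.+ c) (b ℕ.+ d) ⟩
    (a ℕ.+ c) · 1# - (b ℕ.+ d) · 1#         ≈⟨ +-cong (·-homo-+ 1# a c) (-‿cong (·-homo-+ 1# b d)) ⟩
    A + C - (B + D)                         ≈⟨ +-congˡ (⁻¹-∙-comm B D) ⟨
    A + C + (- B - D)                       ≈⟨ swap A C (- B) (- D) ⟩
    (A - B) + (C - D)                       ≈⟨ +-cong (⟦⟧≈ a b) (⟦⟧≈ c d) ⟨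
    ⟦ a , b ⟧ + ⟦ c , d ⟧                   ∎
    where
    A = a · 1#
    B = b · 1#
    C = c · 1#
    D = d · 1#
    swap : ∀ x y z w → x + y + (z + w) ≈ x + z + (y + w)
    swap = ℕ-Solver.solve 4 (λ x y z w → (x ⊕ y) ⊕ (z ⊕ w) ⊜ (x ⊕ z) ⊕ (y ⊕ w)) refl

  *-homo : ∀ a b c d →
    ⟦ a ℕ.* c ℕ.+ b ℕ.* d , a ℕ.* d ℕ.+ b ℕ.* c ⟧ ≈ ⟦ a , b ⟧ * ⟦ c , d ⟧
  *-homo a b c d = begin
    ⟦ a ℕ.* c ℕ.+ b ℕ.* d , a ℕ.* d ℕ.+ b ℕ.* c ⟧
      ≈⟨ ⟦⟧≈ (a ℕ.* c ℕ.+ b ℕ.* d) (a ℕ.* d ℕ.+ b ℕ.* c) ⟩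
    (a ℕ.* c ℕ.+ b ℕ.* d) · 1# - (a ℕ.* d ℕ.+ b ℕ.* c) · 1#
      ≈⟨ +-cong (combine a c b d) (-‿cong (combine a d b c)) ⟩
    A * C + B * D - (A * D + B * C)
      ≈⟨ +-congˡ (⁻¹-∙-comm (A * D) (B * C)) ⟨
    A * C + B * D + (- (A * D) - B * C)
      ≈⟨ +-cong (+-congˡ negatives) (+-cong (-‿distribʳ-* A D) (-‿distribˡ-* B C)) ⟩
    A * C + - B * - D + (A * - D + - B * C)
      ≈⟨ expand A (- B) C (- D) ⟨
    (A - B) * (C - D)
      ≈⟨ *-cong (⟦⟧≈ a b) (⟦⟧≈ c d) ⟨
    ⟦ a , b ⟧ * ⟦ c , d ⟧ ∎
    where
    A = a · 1#
    B = b · 1#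
    C = c · 1#
    D = d · 1#
    combine : ∀ k l m n → (k ℕ.* l ℕ.+ m ℕ.* n) · 1# ≈ (k · 1#) * (l · 1#) + (m · 1#) * (n · 1#)
    combine k l m n = trans (·-homo-+ 1# (k ℕ.* l) (m ℕ.* n)) (+-cong (·1-homo-* k l) (·1-homo-* m n))
    negatives : B * D ≈ - B * - D
    negatives = begin
      B * D         ≈⟨ ⁻¹-involutive (B * D) ⟨
      - - (B * D)   ≈⟨ -‿cong (-‿distribˡ-* B D) ⟩
      - (- B * D)   ≈⟨ -‿distribʳ-* (- B) D ⟩
      - B * - D     ∎
    expand : ∀ x y z w → (x + y) * (z + w) ≈ x * z + y * w + (x * w + y * z)
    expand = ℕ-Solver.solve 4 (λ x y z w → (x ⊕ y) ⊗ (z ⊕ w) ⊜ (x ⊗ z ⊕ y ⊗ w) ⊕ (x ⊗ w ⊕ y ⊗ z)) refl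

  morphism : differenceRing -Raw-AlmostCommutative⟶ fromCommutativeRing R
  morphism = record
    { ⟦_⟧    = ⟦_⟧
    ; +-homo = λ (a , b) (c , d) → trans (⟦⟧-reduce (a ℕ.+ c) (b ℕ.+ d)) (+-homo a b c d)
    ; *-homo = λ (a , b) (c , d) → trans (⟦⟧-reduce (a ℕ.* c ℕ.+ b ℕ.* d) (a ℕ.* d ℕ.+ b ℕ.* c)) (*-homo a b c d)
    ; -‿homo = λ (a , b) → -‿homo a b
    ; 0-homo = refl
    ; 1-homo = refl
    }

  _≟_ : ∀ p q → Maybe (⟦ p ⟧ ≈ ⟦ q ⟧)
  (a , b) ≟ (c , d) = Maybe.map (⟦⟧-cong a b c d) (dec⇒maybe (a ℕ.+ d ℕₚ.≟ c ℕ.+ b))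

  open import Algebra.Solver.Ring differenceRing (fromCommutativeRing R) morphism _≟_ public
    using (solve; con; _:=_; _:+_; _:*_; _:-_; :-_)

-- Ordered field arithmetic, finite sums and running totals

module OrderedField {c ℓ₁ ℓ₂} (F : ArchimedeanOrderedField c ℓ₁ ℓ₂) where

  open ArchimedeanOrderedField F
  open CommutativeRing commutativeRing public
    using ( refl; sym; trans; setoid; semiring; +-monoid; +-commutativeMonoid
          ; +-cong; +-congˡ; +-congʳ; *-cong; *-congˡ; *-congʳ; -‿cong
          ; +-assoc; +-identityˡ; +-identityʳ; *-comm; *-identityˡ; *-identityʳ; zeroˡ; zeroʳ)
  open IsDecTotalOrder isDecTotalOrder public
    using (_≟_; _≤?_; total; antisym; ≤-respˡ-≈; ≤-respʳ-≈)
    renaming (refl to ≤-refl; reflexive to ≤-reflexive; trans to ≤-trans)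
  open IntegerCoefficients commutativeRing using (solve; con; _:=_; _:+_; _:*_; _:-_; :-_)
  open import Relation.Binary.Reasoning.Setoid setoid
  open import Algebra.Properties.Semiring.Mult semiring using (×-assoc-*; ×-congʳ)
  open import Algebra.Properties.Monoid.Sum +-monoid using (sum-init-last)

  x≤y⇒0≤y-x : ∀ {x y} → x ≤ y → 0# ≤ y - x
  x≤y⇒0≤y-x {x} {y} x≤y = ≤-respˡ-≈ (solve 1 (λ x → x :- x := con (0 , 0)) refl x) (+-monoˡ-≤ (- x) x≤y)

  -- The form in which most inequalities below are proved: the slack is exhibited as a visibly
  -- nonnegative `z`, and what remains is an identity, mostly left to the ring solver.
  difference : ∀ {x y z} → 0# ≤ z → z ≈ y - x → x ≤ y
  difference {x} {y} {z} 0≤z z≈y-x = ≤-respˡ-≈ (+-identityˡ x)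
    (≤-respʳ-≈ (trans (+-congʳ z≈y-x) (solve 2 (λ x y → y :- x :+ x := y) refl x y)) (+-monoˡ-≤ x 0≤z))

  +-mono-≤ : ∀ {x y u v} → x ≤ y → u ≤ v → x + u ≤ y + v
  +-mono-≤ {x} {y} {u} {v} x≤y u≤v = ≤-trans (+-monoˡ-≤ u x≤y)
    (difference (x≤y⇒0≤y-x u≤v) (solve 3 (λ y u v → v :- u := (y :+ v) :- (y :+ u)) refl y u v))

  +-nonNeg : ∀ {x y} → 0# ≤ x → 0# ≤ y → 0# ≤ x + y
  +-nonNeg 0≤x 0≤y = ≤-respˡ-≈ (+-identityˡ 0#) (+-mono-≤ 0≤x 0≤y)

  *-monoʳ-≤ : ∀ {x y z} → 0# ≤ z → x ≤ y → z * x ≤ z * y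
  *-monoʳ-≤ {x} {y} {z} 0≤z x≤y = difference (*-nonNeg 0≤z (x≤y⇒0≤y-x x≤y))
    (solve 3 (λ x y z → z :* (y :- x) := z :* y :- z :* x) refl x y z)

  0≤1 : 0# ≤ 1#
  0≤1 with total 0# 1#
  ... | inj₁ 0≤1 = 0≤1
  ... | inj₂ 1≤0 = ≤-respʳ-≈ (solve 0 ((con (0 , 0) :- con (1 , 0)) :* (con (0 , 0) :- con (1 , 0)) := con (1 , 0)) refl)
    (*-nonNeg (x≤y⇒0≤y-x 1≤0) (x≤y⇒0≤y-x 1≤0))

  <-≤-trans : ∀ {x y} → 0# < x → x ≤ y → 0# < y
  <-≤-trans (0≤x , 0≉x) x≤y = ≤-trans 0≤x x≤y , λ 0≈y → 0≉x (antisym 0≤x (≤-respʳ-≈ (sym 0≈y) x≤y))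

  pos⇒≉0 : ∀ {x} → 0# < x → ¬ (x ≈ 0#)
  pos⇒≉0 (_ , 0≉x) x≈0 = 0≉x (sym x≈0)

  x≰y⇒0<x-y : ∀ {x y} → ¬ (x ≤ y) → 0# < x - y
  x≰y⇒0<x-y {x} {y} x≰y with total x y
  ... | inj₁ x≤y = ⊥-elim (x≰y x≤y)
  ... | inj₂ y≤x = x≤y⇒0≤y-x y≤x , λ 0≈x-y → x≰y (difference ≤-refl (trans (solve 0 (con (0 , 0) := :- con (0 , 0)) refl)
    (trans (-‿cong 0≈x-y) (solve 2 (λ x y → :- (x :- y) := y :- x) refl x y))))

  *-/-cancel : ∀ {x} y → 0# < x → x * (y / x) ≈ y
  *-/-cancel {x} y 0<x = begin
    x * (y * x ⁻¹)   ≈⟨ solve 3 (λ x y z → x :* (y :* z) := y :* (x :* z)) refl x y (x ⁻¹) ⟩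
    y * (x * x ⁻¹)   ≈⟨ *-congˡ (*-inverseʳ x (pos⇒≉0 0<x)) ⟩
    y * 1#           ≈⟨ *-identityʳ y ⟩
    y                ∎

  -- Were the inverse nonpositive, `x * (0# - x ⁻¹)` would be nonnegative; but it equals `0# - 1#`.
  ⁻¹-nonNeg : ∀ {x} → 0# < x → 0# ≤ x ⁻¹
  ⁻¹-nonNeg {x} 0<x with total 0# (x ⁻¹)
  ... | inj₁ 0≤x⁻¹ = 0≤x⁻¹
  ... | inj₂ x⁻¹≤0 = ⊥-elim (0≉1 (antisym 0≤1 (difference (*-nonNeg (proj₁ 0<x) (x≤y⇒0≤y-x x⁻¹≤0))
    (trans (solve 2 (λ x y → x :* (con (0 , 0) :- y) := con (0 , 0) :- x :* y) refl x (x ⁻¹))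
      (+-congˡ (-‿cong (*-inverseʳ x (pos⇒≉0 0<x))))))))

  *-cancelˡ-≤ : ∀ {x y z} → 0# < z → z * x ≤ z * y → x ≤ y
  *-cancelˡ-≤ {x} {y} {z} 0<z zx≤zy = ≤-respˡ-≈ (cancel x) (≤-respʳ-≈ (cancel y) (*-monoʳ-≤ (⁻¹-nonNeg 0<z) zx≤zy))
    where
    cancel : ∀ u → z ⁻¹ * (z * u) ≈ u
    cancel u = trans (solve 3 (λ w z u → w :* (z :* u) := z :* (u :* w)) refl (z ⁻¹) z u) (*-/-cancel u 0<z)

  *-pos : ∀ {x y} → 0# < x → 0# < y → 0# < x * y
  *-pos {x} {y} 0<x 0<y = *-nonNeg (proj₁ 0<x) (proj₁ 0<y) , λ 0≈xy → proj₂ 0<y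
    (antisym (proj₁ 0<y) (*-cancelˡ-≤ 0<x (≤-reflexive (trans (sym 0≈xy) (sym (zeroʳ x))))))

  /-nonNeg : ∀ {x y} → 0# ≤ x → 0# < y → 0# ≤ x / y
  /-nonNeg 0≤x 0<y = *-nonNeg 0≤x (⁻¹-nonNeg 0<y)

  /-pos : ∀ {x y} → 0# < x → 0# < y → 0# < x / y
  /-pos {x} {y} 0<x 0<y = /-nonNeg (proj₁ 0<x) 0<y , λ 0≈x/y → proj₂ 0<x
    (trans (sym (zeroʳ y)) (trans (*-congˡ 0≈x/y) (*-/-cancel x 0<y)))

  x≤y/z : ∀ {x y z} → 0# < z → z * x ≤ y → x ≤ y / z
  x≤y/z {y = y} 0<z zx≤y = *-cancelˡ-≤ 0<z (≤-respʳ-≈ (sym (*-/-cancel y 0<z)) zx≤y)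

  x/z≤y : ∀ {x y z} → 0# < z → x ≤ z * y → x / z ≤ y
  x/z≤y {x} 0<z x≤zy = *-cancelˡ-≤ 0<z (≤-respˡ-≈ (sym (*-/-cancel x 0<z)) x≤zy)

  lowerBound : ∀ {x y} → 0# < x → 0# < y → ∃[ z ] 0# < z × z ≤ x × z ≤ y
  lowerBound {x} {y} 0<x 0<y with total x y
  ... | inj₁ x≤y = x , 0<x , ≤-refl , x≤y
  ... | inj₂ y≤x = y , 0<y , y≤x , ≤-refl

  half : ∀ {x} → 0# < x → ∃[ z ] 0# < z × z + z ≤ x
  half {x} 0<x = x / 2# , /-pos 0<x 0<2 , ≤-reflexive
    (trans (solve 1 (λ y → y :+ y := (con (1 , 0) :+ con (1 , 0)) :* y) refl (x / 2#)) (*-/-cancel x 0<2))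
    where
    2# = 1# + 1#
    0<2 : 0# < 2#
    0<2 = <-≤-trans (0≤1 , 0≉1) (difference 0≤1 (solve 0 (con (1 , 0) := con (1 , 0) :+ con (1 , 0) :- con (1 , 0)) refl))

  ·≈* : ∀ n x → n · x ≈ (n · 1#) * x
  ·≈* n x = trans (×-congʳ n (sym (*-identityˡ x))) (sym (×-assoc-* n 1# x))

  ·-nonNeg : ∀ n {x} → 0# ≤ x → 0# ≤ n · x
  ·-nonNeg zero    0≤x = ≤-refl
  ·-nonNeg (suc n) 0≤x = +-nonNeg 0≤x (·-nonNeg n 0≤x)

  sum-mono-≤ : ∀ {n} {f g : Fin n → Carrier} → (∀ i → f i ≤ g i) → sum f ≤ sum g
  sum-mono-≤ {zero}  f≤g = ≤-refl
  sum-mono-≤ {suc n} f≤g = +-mono-≤ (f≤g zero) (sum-mono-≤ (f≤g ∘ suc))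

  sum-nonNeg : ∀ {n} {f : Fin n → Carrier} → (∀ i → 0# ≤ f i) → 0# ≤ sum f
  sum-nonNeg {zero}  0≤f = ≤-refl
  sum-nonNeg {suc n} 0≤f = +-nonNeg (0≤f zero) (sum-nonNeg (0≤f ∘ suc))

  sum-init-≤ : ∀ {n} (f : Fin (suc n) → Carrier) → 0# ≤ f (fromℕ n) → sum (f ∘ inject₁) ≤ sum f
  sum-init-≤ f 0≤last = difference 0≤last (trans
    (solve 2 (λ x y → y := (x :+ y) :- x) refl (sum (f ∘ inject₁)) (f (fromℕ _)))
    (+-congʳ (sym (sum-init-last f))))

  Within : Carrier → Carrier → Set ℓ₂
  Within B x = 0# ≤ x × x ≤ B

  within-resp-≈ : ∀ {B x y} → x ≈ y → Within B x → Within B y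
  within-resp-≈ x≈y (0≤x , x≤B) = ≤-respʳ-≈ x≈y 0≤x , ≤-respˡ-≈ x≈y x≤B

  -- Whatever the sign of `y`, the point `x + y` lies between the other two, and `Within B` is an
  -- interval.
  within-step : ∀ {B} n {x y} → Within B x → Within B (x + suc n · y) → Within B (x + y)
  within-step n {x} {y} (0≤x , x≤B) (0≤z , z≤B) with total 0# y
  ... | inj₁ 0≤y = +-nonNeg 0≤x 0≤y , ≤-trans (difference (·-nonNeg n 0≤y)
          (solve 3 (λ x y z → z := (x :+ (y :+ z)) :- (x :+ y)) refl x y (n · y))) z≤B
  ... | inj₂ y≤0 = ≤-trans 0≤z (difference (x≤y⇒0≤y-x (·-nonPos n))
          (solve 3 (λ x y z → con (0 , 0) :- z := (x :+ y) :- (x :+ (y :+ z))) refl x y (n · y)))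
        , ≤-trans (difference (x≤y⇒0≤y-x y≤0) (solve 2 (λ x y → con (0 , 0) :- y := x :- (x :+ y)) refl x y)) x≤B
    where
    ·-nonPos : ∀ n → n · y ≤ 0#
    ·-nonPos zero    = ≤-refl
    ·-nonPos (suc n) = ≤-respʳ-≈ (+-identityˡ 0#) (+-mono-≤ y≤0 (·-nonPos n))

  last-≤-sum : ∀ {n} (f : Fin (suc n) → Carrier) → (∀ i → 0# ≤ f i) → f (fromℕ n) ≤ sum f
  last-≤-sum f 0≤f = ≤-respʳ-≈ (sym (sum-init-last f)) (≤-respˡ-≈ (+-identityˡ _)
    (+-monoˡ-≤ _ (sum-nonNeg (0≤f ∘ inject₁))))

  -- Absorbing the first increment into the base matches the recursion of `phase`, so that an
  -- induction on `n` peels off one early slot by computation.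
  level : ∀ {n} → Carrier → (Fin n → Carrier) → Fin (suc n) → Carrier
  level         b g zero    = b
  level {suc n} b g (suc i) = level (b + g zero) (g ∘ suc) i

  level-suc : ∀ {n} b (g : Fin n → Carrier) t → level b g (suc t) ≈ level b g (inject₁ t) + g t
  level-suc b g zero    = refl
  level-suc b g (suc t) = level-suc (b + g zero) (g ∘ suc) t

  level-last : ∀ {n} b (g : Fin n → Carrier) → level b g (fromℕ n) ≈ b + sum g
  level-last {zero}  b g = sym (+-identityʳ b)
  level-last {suc n} b g = trans (level-last (b + g zero) (g ∘ suc)) (+-assoc b _ _)

  telescope-≤ : ∀ {n} (x : Fin (suc n) → Carrier) (g : Fin n → Carrier) →
    (∀ t → x (suc t) ≤ x (inject₁ t) + g t) → x (fromℕ n) ≤ x zero + sum g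
  telescope-≤ {zero}  x g step = ≤-reflexive (sym (+-identityʳ _))
  telescope-≤ {suc n} x g step = ≤-trans (telescope-≤ (x ∘ suc) (g ∘ suc) (step ∘ suc))
    (≤-respʳ-≈ (+-assoc _ _ _) (+-monoˡ-≤ _ (step zero)))

-- The three phases of the horizon, with sums and levels over them

data Phase : Set where
  early crunch flood : Phase

phase : ∀ n → Fin (suc (suc n)) → Phase
phase zero    zero       = crunch
phase zero    (suc zero) = flood
phase (suc n) zero       = early
phase (suc n) (suc t)    = phase n t

-- Among the `suc (suc n)` slots, the early ones are `inject₁ (inject₁ j)`, the crunch slot is
-- `inject₁ (fromℕ n)` and the flood slot is `fromℕ (suc n)`.
phase-early : ∀ {n} (j : Fin n) (τ : Fin (suc (suc n))) → τ Fin.≤ inject₁ (inject₁ j) → phase n τ ≡ early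
phase-early {suc n} j       zero    _           = ≡.refl
phase-early {suc n} (suc j) (suc τ) (ℕ.s≤s τ≤j) = phase-early j τ τ≤j

phase-crunch : ∀ n → phase n (inject₁ (fromℕ n)) ≡ crunch
phase-crunch zero    = ≡.refl
phase-crunch (suc n) = phase-crunch n

module PhaseSums {c ℓ₁ ℓ₂} (F : ArchimedeanOrderedField c ℓ₁ ℓ₂) where

  open ArchimedeanOrderedField F
  open OrderedField F

  sum-phase : ∀ n (f : Phase → Carrier) → sum (f ∘ phase n) ≈ n · f early + (f crunch + f flood)
  sum-phase zero    f = trans (+-congˡ (+-identityʳ _)) (sym (+-identityˡ _))
  sum-phase (suc n) f = trans (+-congˡ (sum-phase n f)) (sym (+-assoc _ _ _))

  sum-phase-init : ∀ n (f : Phase → Carrier) → sum (f ∘ phase n ∘ inject₁) ≈ n · f early + f crunch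
  sum-phase-init zero    f = trans (+-identityʳ _) (sym (+-identityˡ _))
  sum-phase-init (suc n) f = trans (+-congˡ (sum-phase-init n f)) (sym (+-assoc _ _ _))

  -- Over the early slots the level is linear in time, so its two end values control all values
  -- between them.
  level-within : ∀ {B} n {b} (g : Phase → Carrier) → Within B b →
    Within B (b + n · g early) →
    Within B (b + n · g early + g crunch) →
    Within B (b + n · g early + g crunch + g flood) →
    ∀ i → Within B (level b (g ∘ phase n) i)
  level-within n       g w₀ w₁ w₂ w₃ zero             = w₀
  level-within zero    g w₀ w₁ w₂ w₃ (suc zero)       =
    within-resp-≈ (+-congʳ (+-identityʳ _)) w₂
  level-within zero    g w₀ w₁ w₂ w₃ (suc (suc zero)) =
    within-resp-≈ (+-congʳ (+-congʳ (+-identityʳ _))) w₃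
  level-within (suc n) g w₀ w₁ w₂ w₃ (suc i)          =
    level-within n g (within-step n w₀ w₁)
      (within-resp-≈ shift w₁)
      (within-resp-≈ (+-congʳ shift) w₂)
      (within-resp-≈ (+-congʳ (+-congʳ shift)) w₃) i
    where
    shift = sym (+-assoc _ _ _)

-- The adversarial inputs and their parameters

module Adversary {c ℓ₁ ℓ₂} (F : ArchimedeanOrderedField c ℓ₁ ℓ₂) where

  open ArchimedeanOrderedField F
  open EnergyStorage F
  open OrderedField F
  open PhaseSums F
  open IntegerCoefficients commutativeRing using (solve; con; _:=_; _:+_; _:*_; _:-_)
  open import Relation.Binary.Reasoning.Setoid setoid
  open import Algebra.Properties.Monoid.Sum +-monoid using (sum-init-last; sum-cong-≋)
  open import Algebra.Properties.CommutativeMonoid.Sum +-commutativeMonoid using (∑-distrib-+)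
  open import Algebra.Properties.Semiring.Sum semiring using (*-distribˡ-sum)

  -- E is the lowest level from which one charging slot can reach Be, and e is the
  -- energy that serves the demand δ of one slot.
  record Parameters (S : System) : Set (c Level.⊔ ℓ₁ Level.⊔ ℓ₂) where
    open System S
    field
      n        : ℕ
      E e      : Carrier
      0≤E      : 0# ≤ E
      E≤Be     : E ≤ Be
      Be≤E+ημ  : Be ≤ E + ηc * μc
      E-least  : ∀ y → 0# ≤ y → Be ≤ y + ηc * μc → E ≤ y
      0<e      : 0# < e
      e+e≤ημ   : e + e ≤ ηc * μc
      e≤ημd    : e ≤ ηd * μd
      E+e≤B    : E + e ≤ B
      B≤ne     : B ≤ (n · 1#) * e

  module Slack (S : System) where

    open System S

    -- `e` is at most half of `ηc * μc` because an early slot stores `e + w` with `w ≤ e`; at most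
    -- `ηd * μd` so that discharging alone can serve `δ`; and at most `B - E` so that the energy for
    -- the crunch fits on top of `E`. The Archimedean property then supplies enough early slots.
    build : ∀ E → 0# ≤ E → E ≤ Be → Be ≤ E + ηc * μc →
      (∀ y → 0# ≤ y → Be ≤ y + ηc * μc → E ≤ y) → 0# < B - E → Parameters S
    build E 0≤E E≤Be Be≤E+ημ E-least 0<B-E =
      let h , 0<h , h+h≤ημ = half (*-pos 0<ηc 0<μc)
          f , 0<f , f≤h , f≤ημ = lowerBound 0<h (*-pos (<-≤-trans (0≤1 , 0≉1) 1≤ηd) 0<μd)
          e , 0<e , e≤f , e≤B-E = lowerBound 0<f 0<B-E
          n , B/e≤n = archimedean (B / e)
      in record
        { n       = n
        ; E       = E
        ; e       = e
        ; 0≤E     = 0≤E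
        ; E≤Be    = E≤Be
        ; Be≤E+ημ = Be≤E+ημ
        ; E-least = E-least
        ; 0<e     = 0<e
        ; e+e≤ημ  = ≤-trans (+-mono-≤ (≤-trans e≤f f≤h) (≤-trans e≤f f≤h)) h+h≤ημ
        ; e≤ημd   = ≤-trans e≤f f≤ημ
        ; E+e≤B   = difference (x≤y⇒0≤y-x e≤B-E)
                      (solve 3 (λ b x y → b :- x :- y := b :- (x :+ y)) refl B E e)
        ; B≤ne    = ≤-respˡ-≈ (*-/-cancel B 0<e)
                      (≤-respʳ-≈ (*-comm e (n · 1#)) (*-monoʳ-≤ (proj₁ 0<e) B/e≤n))
        }

  -- The two cases compute `E` as the maximum of `0#` and `Be - ηc * μc`. It is strictly below `B`
  -- by `0<B` in the first case, and in the second because `Be ≤ B` and `ηc * μc` is positive.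
  parameters : (S : System) → Parameters S
  parameters S with Be ≤? ηc * μc
    where open System S
  ... | yes Be≤ημ = build 0# ≤-refl 0≤Be (≤-respʳ-≈ (sym (+-identityˡ _)) Be≤ημ) (λ _ 0≤y _ → 0≤y)
        (<-≤-trans 0<B (≤-reflexive (solve 1 (λ x → x := x :- con (0 , 0)) refl _)))
    where
    open System S
    open Slack S
  ... | no Be≰ημ = build (Be - ηc * μc) (proj₁ (x≰y⇒0<x-y Be≰ημ))
        (difference (proj₁ (*-pos 0<ηc 0<μc)) (solve 2 (λ x y → y := x :- (x :- y)) refl Be (ηc * μc)))
        (≤-reflexive (solve 2 (λ x y → x := x :- y :+ y) refl Be (ηc * μc)))
        (λ y _ Be≤y+ημ → difference (x≤y⇒0≤y-x Be≤y+ημ)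
          (solve 3 (λ x y z → y :+ z :- x := y :- (x :- z)) refl Be y (ηc * μc)))
        (<-≤-trans (*-pos 0<ηc 0<μc) (difference (x≤y⇒0≤y-x Be≤B)
          (solve 3 (λ b x y → b :- x := b :- (x :- y) :- y) refl B Be (ηc * μc))))
    where
    open System S
    open Slack S

  module _ (S : System) (P : Parameters S) (m M : Carrier) (0<m : 0# < m) (m≤M : m ≤ M) where

    open System S
    open Parameters P

    -- w is the change of the level in an early slot without purchase.
    κ w δ r₁ R : Carrier
    κ  = n · 1#
    w  = (E - Bs) / κ
    δ  = e / ηd
    -- Stored in full, this adds `e + w`; withdrawing `e` for the demand `δ` leaves the net change
    -- `w`.
    r₁ = (e + w) / ηc
    -- `B` covers any refill from `E` to `Be`, and `κ * e + e` the stored energy for a demand `δ` in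
    -- all early slots and the crunch slot.
    R  = (B + (κ * e + e)) / ηc

    demandAt : Carrier → Phase → Carrier
    demandAt γ early  = δ
    demandAt γ crunch = γ
    demandAt γ flood  = 0#

    priceAt renewableAt : Phase → Carrier
    priceAt early  = m
    priceAt crunch = M
    priceAt flood  = m
    renewableAt early  = r₁
    renewableAt crunch = 0#
    renewableAt flood  = R

    input : Carrier → Input (suc (suc n))
    input γ = record
      { a = demandAt γ ∘ phase n
      ; p = priceAt ∘ phase n
      ; r = renewableAt ∘ phase n
      }

    0<ηd : 0# < ηd
    0<ηd = <-≤-trans (0≤1 , 0≉1) 1≤ηd

    -- There is at least one early slot, since `n = 0` would turn `B≤ne` into `B ≤ 0#`.
    1≤κ : 1# ≤ κ
    1≤κ = go n B≤ne
      where
      go : ∀ k → B ≤ (k · 1#) * e → 1# ≤ k · 1#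
      go zero    B≤0 = ⊥-elim (proj₂ 0<B (antisym (proj₁ 0<B) (≤-respʳ-≈ (zeroˡ e) B≤0)))
      go (suc k) _   = difference (·-nonNeg k 0≤1) (solve 1 (λ x → x := con (1 , 0) :+ x :- con (1 , 0)) refl _)

    0<κ : 0# < κ
    0<κ = <-≤-trans (0≤1 , 0≉1) 1≤κ

    0<δ : 0# < δ
    0<δ = /-pos 0<e 0<ηd

    ηdδ≈e : ηd * δ ≈ e
    ηdδ≈e = *-/-cancel e 0<ηd

    ηcr₁≈e+w : ηc * r₁ ≈ e + w
    ηcr₁≈e+w = *-/-cancel (e + w) 0<ηc

    κw≈E-Bs : κ * w ≈ E - Bs
    κw≈E-Bs = *-/-cancel (E - Bs) 0<κ

    -- Even the steepest descent loses at most `e` per early slot: in total it is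
    -- `Bs - E ≤ B ≤ κ * e`. So the early renewable energy is nonnegative.
    0≤e+w : 0# ≤ e + w
    0≤e+w = *-cancelˡ-≤ 0<κ (difference
      (+-nonNeg (x≤y⇒0≤y-x B≤ne) (+-nonNeg (x≤y⇒0≤y-x Bs≤B) 0≤E))
      (begin
        κ * e - B + (B - Bs + E)
          ≈⟨ solve 4 (λ x b s y → x :- b :+ (b :- s :+ y) := x :+ (y :- s)) refl (κ * e) B Bs E ⟩
        κ * e + (E - Bs)
          ≈⟨ +-congˡ κw≈E-Bs ⟨
        κ * e + κ * w
          ≈⟨ solve 3 (λ k x y → k :* x :+ k :* y := k :* (x :+ y) :- k :* con (0 , 0)) refl κ e w ⟩
        κ * (e + w) - κ * 0# ∎))

    -- The rise over all early slots is `E - Bs ≤ B ≤ κ * e`.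
    w≤e : w ≤ e
    w≤e = *-cancelˡ-≤ 0<κ (≤-respˡ-≈ (sym κw≈E-Bs) (≤-trans
      (difference (+-nonNeg (x≤y⇒0≤y-x (≤-trans E≤Be Be≤B)) 0≤Bs)
        (solve 3 (λ b x y → b :- x :+ y := b :- (x :- y)) refl B E Bs))
      B≤ne))

    e+w≤ημ : e + w ≤ ηc * μc
    e+w≤ημ = ≤-trans (+-mono-≤ ≤-refl w≤e) e+e≤ημ

    0≤r₁ : 0# ≤ r₁
    0≤r₁ = /-nonNeg 0≤e+w 0<ηc

    δ≤μd : δ ≤ μd
    δ≤μd = x/z≤y 0<ηd e≤ημd

    0≤R : 0# ≤ R
    0≤R = /-nonNeg (+-nonNeg (proj₁ 0<B) (+-nonNeg (*-nonNeg (proj₁ 0<κ) (proj₁ 0<e)) (proj₁ 0<e))) 0<ηc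

    -- The change of the level when nothing is bought and all renewable energy is stored.
    net : Carrier → Phase → Carrier
    net γ ph = ηc * renewableAt ph - ηd * demandAt γ ph

    bought : Schedule (suc (suc n)) → Fin (suc (suc n)) → Carrier
    bought s t = Schedule.va s t + Schedule.vb s t

    payment : Schedule (suc (suc n)) → Fin (suc (suc n)) → Carrier
    payment s t = priceAt (phase n t) * bought s t

    -- Lower bound on the cost of every feasible schedule

    module _ {γ : Carrier} {s : Schedule (suc (suc n))} (feasible : Feasible S (input γ) s) where

      open Schedule s
      open Feasible feasible

      level-step-≤ : ∀ t → x (suc t) ≤ x (inject₁ t) + (net γ (phase n t) + ηd * bought s t)
      level-step-≤ t = difference
        (+-nonNeg (*-nonNeg (proj₁ 0<ηc) (x≤y⇒0≤y-x (renewable t)))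
                  (*-nonNeg (x≤y⇒0≤y-x (≤-trans ηc≤1 1≤ηd)) (0≤vb t)))
        (begin
          ηc * (r - rb t) + (ηd - ηc) * vb t
            ≈⟨ solve 8 (λ ηc ηd r rb x d va vb →
                 ηc :* (r :- rb) :+ (ηd :- ηc) :* vb :=
                 x :+ (ηc :* r :- ηd :* (d :+ va) :+ ηd :* (va :+ vb)) :- (x :+ ηc :* (rb :+ vb) :- ηd :* d))
                 refl ηc ηd r (rb t) (x (inject₁ t)) (d t) (va t) (vb t) ⟩
          x (inject₁ t) + (ηc * r - ηd * (d t + va t) + ηd * bought s t)
            - (x (inject₁ t) + ηc * (rb t + vb t) - ηd * d t)
            ≈⟨ +-cong (+-congˡ (+-congʳ (+-congˡ (-‿cong (*-congˡ (demand t)))))) (-‿cong (sym (dynamics t))) ⟩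
          x (inject₁ t) + (net γ (phase n t) + ηd * bought s t) - x (suc t) ∎)
        where
        r = renewableAt (phase n t)

      -- The flood slot can raise the level by at most `ηc * μc` and must end at `Be`, so `E-least`
      -- applies to the level before it.
      E≤level : E ≤ x (inject₁ (fromℕ (suc n)))
      E≤level = E-least _ (0≤x _) (≤-respˡ-≈ terminal (≤-respˡ-≈ (sym (dynamics t)) (difference
        (+-nonNeg (*-nonNeg (proj₁ 0<ηc) (x≤y⇒0≤y-x (charge t))) (*-nonNeg (proj₁ 0<ηd) (0≤d t)))
        (solve 6 (λ ηc ηd x c μ d → ηc :* (μ :- c) :+ ηd :* d := (x :+ ηc :* μ) :- (x :+ ηc :* c :- ηd :* d))
          refl ηc ηd (x (inject₁ t)) (rb t + vb t) μc (d t)))))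
        where
        t = fromℕ (suc n)

      -- Without purchases the level before the flood slot would be at most `E - ηd * γ`: the early
      -- slots lead from `Bs` to `E` and the crunch takes `ηd * γ`. Since it is at least `E`,
      -- purchases worth at most `ηd` per unit must close the gap.
      γ≤Σbought : γ ≤ sum (bought s ∘ inject₁)
      γ≤Σbought = *-cancelˡ-≤ 0<ηd (difference (x≤y⇒0≤y-x E≤final) (begin
        Bs + (E - Bs - ηd * γ + ηd * V) - E
          ≈⟨ solve 4 (λ s x y z → s :+ (x :- s :- y :+ z) :- x := z :- y) refl Bs E (ηd * γ) (ηd * V) ⟩
        ηd * V - ηd * γ ∎))
        where
        V = sum (bought s ∘ inject₁)
        net-early : net γ early ≈ w
        net-early = trans (+-cong ηcr₁≈e+w (-‿cong ηdδ≈e)) (solve 2 (λ x y → x :+ y :- x := y) refl e w)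
        Σnet : sum (net γ ∘ phase n ∘ inject₁) ≈ E - Bs - ηd * γ
        Σnet = begin
          sum (net γ ∘ phase n ∘ inject₁)  ≈⟨ sum-phase-init n (net γ) ⟩
          n · net γ early + net γ crunch   ≈⟨ +-congʳ (·≈* n _) ⟩
          κ * net γ early + net γ crunch   ≈⟨ +-cong (trans (*-congˡ net-early) κw≈E-Bs) (+-congʳ (zeroʳ ηc)) ⟩
          E - Bs + (0# - ηd * γ)           ≈⟨ +-congˡ (+-identityˡ _) ⟩
          E - Bs - ηd * γ                  ∎
        Σgain : sum (λ t → net γ (phase n (inject₁ t)) + ηd * bought s (inject₁ t)) ≈ E - Bs - ηd * γ + ηd * V
        Σgain = trans (∑-distrib-+ (net γ ∘ phase n ∘ inject₁) (λ t → ηd * bought s (inject₁ t)))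
          (+-cong Σnet (sym (*-distribˡ-sum ηd (bought s ∘ inject₁))))
        E≤final : E ≤ Bs + (E - Bs - ηd * γ + ηd * V)
        E≤final = ≤-trans E≤level (≤-respʳ-≈ (+-cong initial Σgain)
          (telescope-≤ (x ∘ inject₁) _ (level-step-≤ ∘ inject₁)))

      bought-nonNeg : ∀ t → 0# ≤ bought s t
      bought-nonNeg t = +-nonNeg (0≤va t) (0≤vb t)

      m≤price : ∀ ph → m ≤ priceAt ph
      m≤price early  = ≤-refl
      m≤price crunch = m≤M
      m≤price flood  = ≤-refl

      payment-nonNeg : ∀ t → 0# ≤ payment s t
      payment-nonNeg t = *-nonNeg (≤-trans (proj₁ 0<m) (m≤price (phase n t))) (bought-nonNeg t)

      mΣbought≤cost : m * sum (bought s ∘ inject₁) ≤ cost (input γ) s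
      mΣbought≤cost = ≤-trans
        (≤-respˡ-≈ (sym (*-distribˡ-sum m (bought s ∘ inject₁))) (sum-mono-≤ λ t →
          ≤-respˡ-≈ (*-comm _ m) (≤-respʳ-≈ (*-comm _ _)
            (*-monoʳ-≤ (bought-nonNeg (inject₁ t)) (m≤price (phase n (inject₁ t)))))))
        (sum-init-≤ (payment s) (payment-nonNeg (fromℕ (suc n))))

      mγ≤cost : m * γ ≤ cost (input γ) s
      mγ≤cost = ≤-trans (*-monoʳ-≤ (proj₁ 0<m) γ≤Σbought) mΣbought≤cost

    -- An offline schedule attaining the lower bound

    module Offline {γ : Carrier} (0≤γ : 0# ≤ γ) (γ≤δ : γ ≤ δ) where

      q : Carrier
      q = γ / κ

      κq≈γ : κ * q ≈ γ
      κq≈γ = *-/-cancel γ 0<κ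

      0≤q : 0# ≤ q
      0≤q = /-nonNeg 0≤γ 0<κ

      q≤δ : q ≤ δ
      q≤δ = x/z≤y 0<κ (≤-trans γ≤δ (difference
        (*-nonNeg (proj₁ 0<δ) (x≤y⇒0≤y-x 1≤κ))
        (solve 2 (λ d k → d :* (k :- con (1 , 0)) := k :* d :- d) refl δ κ)))

      refill : Carrier
      refill = (Be - E) / ηc

      ηc*refill≈Be-E : ηc * refill ≈ Be - E
      ηc*refill≈Be-E = *-/-cancel (Be - E) 0<ηc

      0≤refill : 0# ≤ refill
      0≤refill = /-nonNeg (x≤y⇒0≤y-x E≤Be) 0<ηc

      -- Purchases serve early demand directly and are never stored. Each unit so spares a discharge
      -- of `ηd`, exactly what one unit of crunch demand costs, and no conversion loss occurs.
      d rb va : Phase → Carrier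
      d early   = δ - q
      d crunch  = γ
      d flood   = 0#
      rb early  = r₁
      rb crunch = 0#
      rb flood  = refill
      va early  = q
      va crunch = 0#
      va flood  = 0#

      gain : Phase → Carrier
      gain ph = ηc * (rb ph + 0#) - ηd * d ph

      schedule : Schedule (suc (suc n))
      schedule = record
        { x  = level Bs (gain ∘ phase n)
        ; d  = d ∘ phase n
        ; rb = rb ∘ phase n
        ; va = va ∘ phase n
        ; vb = λ _ → 0#
        }

      -- The spared discharges add up to `ηd * (κ * q)`, which is the surplus over `E` that the
      -- crunch slot consumes.
      after-early : Bs + n · gain early ≈ E + ηd * γ
      after-early = begin
        Bs + n · gain early
          ≈⟨ +-congˡ (·≈* n _) ⟩
        Bs + κ * gain early
          ≈⟨ solve 7 (λ s k ηc r ηd d q → s :+ k :* (ηc :* (r :+ con (0 , 0)) :- ηd :* (d :- q)) :=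
               s :+ (k :* (ηc :* r :- ηd :* d)) :+ ηd :* (k :* q)) refl Bs κ ηc r₁ ηd δ q ⟩
        Bs + κ * (ηc * r₁ - ηd * δ) + ηd * (κ * q)
          ≈⟨ +-cong (+-congˡ (*-congˡ (+-cong ηcr₁≈e+w (-‿cong ηdδ≈e)))) (*-congˡ κq≈γ) ⟩
        Bs + κ * (e + w - e) + ηd * γ
          ≈⟨ solve 5 (λ s k e w z → s :+ k :* (e :+ w :- e) :+ z := s :+ k :* w :+ z) refl Bs κ e w (ηd * γ) ⟩
        Bs + κ * w + ηd * γ
          ≈⟨ +-congʳ (+-congˡ κw≈E-Bs) ⟩
        Bs + (E - Bs) + ηd * γ
          ≈⟨ solve 3 (λ s x z → s :+ (x :- s) :+ z := x :+ z) refl Bs E (ηd * γ) ⟩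
        E + ηd * γ ∎

      after-crunch : Bs + n · gain early + gain crunch ≈ E
      after-crunch = trans (+-congʳ after-early)
        (solve 4 (λ x ηd γ ηc → x :+ ηd :* γ :+ (ηc :* (con (0 , 0) :+ con (0 , 0)) :- ηd :* γ) := x) refl E ηd γ ηc)

      after-flood : Bs + n · gain early + gain crunch + gain flood ≈ Be
      after-flood = begin
        Bs + n · gain early + gain crunch + (ηc * (refill + 0#) - ηd * 0#)
          ≈⟨ +-cong after-crunch
               (solve 3 (λ c r d → c :* (r :+ con (0 , 0)) :- d :* con (0 , 0) := c :* r) refl ηc refill ηd) ⟩
        E + ηc * refill
          ≈⟨ +-congˡ ηc*refill≈Be-E ⟩
        E + (Be - E)
          ≈⟨ solve 2 (λ x y → x :+ (y :- x) := y) refl E Be ⟩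
        Be ∎

      ηdγ≤e : ηd * γ ≤ e
      ηdγ≤e = ≤-respʳ-≈ ηdδ≈e (*-monoʳ-≤ (proj₁ 0<ηd) γ≤δ)

      0≤ηdγ : 0# ≤ ηd * γ
      0≤ηdγ = *-nonNeg (proj₁ 0<ηd) 0≤γ

      within : ∀ t → Within B (level Bs (gain ∘ phase n) t)
      within = level-within n gain (0≤Bs , Bs≤B)
        -- The level just before the crunch; `E+e≤B` leaves room for it because `ηd * γ ≤ e`.
        (within-resp-≈ (sym after-early) (+-nonNeg 0≤E 0≤ηdγ , ≤-trans (+-mono-≤ ≤-refl ηdγ≤e) E+e≤B))
        (within-resp-≈ (sym after-crunch) (0≤E , ≤-trans E≤Be Be≤B))
        (within-resp-≈ (sym after-flood) (0≤Be , Be≤B))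

      demand-met : ∀ ph → d ph + va ph ≈ demandAt γ ph
      demand-met early  = solve 2 (λ x y → x :- y :+ y := x) refl δ q
      demand-met crunch = +-identityʳ γ
      demand-met flood  = +-identityʳ 0#

      rb≤r : ∀ ph → rb ph ≤ renewableAt ph
      rb≤r early  = ≤-refl
      rb≤r crunch = ≤-refl
      rb≤r flood  = x/z≤y 0<ηc (≤-respʳ-≈ (sym (*-/-cancel _ 0<ηc)) (difference
        (+-nonNeg (+-nonNeg (x≤y⇒0≤y-x Be≤B) 0≤E) (+-nonNeg (*-nonNeg (proj₁ 0<κ) (proj₁ 0<e)) (proj₁ 0<e)))
        (solve 4 (λ b x y z → b :- x :+ y :+ z := b :+ z :- (x :- y)) refl B Be E (κ * e + e))))

      rb≤μc : ∀ ph → rb ph ≤ μc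
      rb≤μc early  = x/z≤y 0<ηc e+w≤ημ
      rb≤μc crunch = proj₁ 0<μc
      rb≤μc flood  = x/z≤y 0<ηc (difference (x≤y⇒0≤y-x Be≤E+ημ)
        (solve 3 (λ x y z → x :+ z :- y := z :- (y :- x)) refl E Be (ηc * μc)))

      d≤μd : ∀ ph → d ph ≤ μd
      d≤μd early  = ≤-trans (difference 0≤q (solve 2 (λ x y → y := x :- (x :- y)) refl δ q)) δ≤μd
      d≤μd crunch = ≤-trans γ≤δ δ≤μd
      d≤μd flood  = proj₁ 0<μd

      d-nonNeg : ∀ ph → 0# ≤ d ph
      d-nonNeg early  = x≤y⇒0≤y-x q≤δ
      d-nonNeg crunch = 0≤γ
      d-nonNeg flood  = ≤-refl

      rb-nonNeg : ∀ ph → 0# ≤ rb ph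
      rb-nonNeg early  = 0≤r₁
      rb-nonNeg crunch = ≤-refl
      rb-nonNeg flood  = 0≤refill

      va-nonNeg : ∀ ph → 0# ≤ va ph
      va-nonNeg early  = 0≤q
      va-nonNeg crunch = ≤-refl
      va-nonNeg flood  = ≤-refl

      feasible : Feasible S (input γ) schedule
      feasible = record
        { dynamics  = λ t → trans (level-suc Bs (gain ∘ phase n) t) (sym (+-assoc _ _ _))
        ; demand    = demand-met ∘ phase n
        ; renewable = rb≤r ∘ phase n
        ; 0≤x       = proj₁ ∘ within
        ; x≤B       = proj₂ ∘ within
        ; charge    = λ t → ≤-respˡ-≈ (sym (+-identityʳ _)) (rb≤μc (phase n t))
        ; discharge = d≤μd ∘ phase n
        ; initial   = refl
        ; terminal  = trans (level-last Bs (gain ∘ phase n)) (trans (+-congˡ (sum-phase n gain))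
                        (trans (solve 4 (λ x y z u → x :+ (y :+ (z :+ u)) := x :+ y :+ z :+ u) refl Bs _ _ _) after-flood))
        ; 0≤d       = d-nonNeg ∘ phase n
        ; 0≤rb      = rb-nonNeg ∘ phase n
        ; 0≤va      = va-nonNeg ∘ phase n
        ; 0≤vb      = λ _ → ≤-refl
        }

      cost≈mγ : cost (input γ) schedule ≈ m * γ
      cost≈mγ = begin
        cost (input γ) schedule
          ≈⟨ sum-phase n (λ ph → priceAt ph * (va ph + 0#)) ⟩
        n · (m * (q + 0#)) + (M * (0# + 0#) + m * (0# + 0#))
          ≈⟨ +-congʳ (·≈* n _) ⟩
        κ * (m * (q + 0#)) + (M * (0# + 0#) + m * (0# + 0#))
          ≈⟨ solve 4 (λ k m M q → let o = con (0 , 0) in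
               k :* (m :* (q :+ o)) :+ (M :* (o :+ o) :+ m :* (o :+ o)) := m :* (k :* q)) refl κ m M q ⟩
        m * (κ * q)
          ≈⟨ *-congˡ κq≈γ ⟩
        m * γ ∎

      optimal : Optimal S (input γ) schedule
      optimal = feasible , λ s′ feasible′ → ≤-respˡ-≈ (sym cost≈mγ) (mγ≤cost feasible′)

      -- Admissibility of the inputs and abundance of renewable energy

      demand-nonNeg : ∀ ph → 0# ≤ demandAt γ ph
      demand-nonNeg early  = proj₁ 0<δ
      demand-nonNeg crunch = 0≤γ
      demand-nonNeg flood  = ≤-refl

      renewable-nonNeg : ∀ ph → 0# ≤ renewableAt ph
      renewable-nonNeg early  = 0≤r₁
      renewable-nonNeg crunch = ≤-refl
      renewable-nonNeg flood  = 0≤R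

      price≤M : ∀ ph → priceAt ph ≤ M
      price≤M early  = m≤M
      price≤M crunch = ≤-refl
      price≤M flood  = m≤M

      Σa Σr : Carrier
      Σa = sum (demandAt γ ∘ phase n)
      Σr = sum (renewableAt ∘ phase n)

      Σa≈ : Σa ≈ κ * δ + γ
      Σa≈ = trans (sum-phase n (demandAt γ)) (+-cong (·≈* n δ) (+-identityʳ γ))

      Σr≈ : Σr ≈ κ * r₁ + R
      Σr≈ = trans (sum-phase n renewableAt) (+-cong (·≈* n r₁) (+-identityˡ R))

      0<Σa : 0# < Σa
      0<Σa = <-≤-trans (*-pos 0<κ 0<δ) (difference 0≤γ (trans
        (solve 2 (λ x y → y := x :+ y :- x) refl (κ * δ) γ) (+-congʳ (sym Σa≈))))

      -- The flood alone outweighs all demand: its share `κ * e + e` pays for `κ * e + ηd * γ`,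
      -- while its share `B` and the early renewable energy are left over.
      ηdΣa≤ηcΣr : ηd * Σa ≤ ηc * Σr
      ηdΣa≤ηcΣr = difference
        (+-nonNeg (+-nonNeg (*-nonNeg (proj₁ 0<κ) 0≤e+w) (proj₁ 0<B)) (x≤y⇒0≤y-x ηdγ≤e))
        (begin
          κ * (e + w) + B + (e - ηd * γ)
            ≈⟨ solve 5 (λ k e w b z → k :* (e :+ w) :+ b :+ (e :- z) :=
                 k :* (e :+ w) :+ (b :+ (k :* e :+ e)) :- (k :* e :+ z)) refl κ e w B (ηd * γ) ⟩
          κ * (e + w) + (B + (κ * e + e)) - (κ * e + ηd * γ)
            ≈⟨ +-cong (+-cong (*-congˡ ηcr₁≈e+w) (*-/-cancel _ 0<ηc)) (-‿cong (+-congʳ (*-congˡ ηdδ≈e))) ⟨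
          κ * (ηc * r₁) + ηc * R - (κ * (ηd * δ) + ηd * γ)
            ≈⟨ solve 7 (λ k c r R d δ γ → k :* (c :* r) :+ c :* R :- (k :* (d :* δ) :+ d :* γ) :=
                 c :* (k :* r :+ R) :- d :* (k :* δ :+ γ)) refl κ ηc r₁ R ηd δ γ ⟩
          ηc * (κ * r₁ + R) - ηd * (κ * δ + γ)
            ≈⟨ +-cong (*-congˡ Σr≈) (-‿cong (*-congˡ Σa≈)) ⟨
          ηc * Σr - ηd * Σa ∎)

      1≤ρ : 1# ≤ ρ S (input γ)
      1≤ρ = *-cancelˡ-≤ (*-pos 0<ηd 0<Σa) (≤-respˡ-≈ (sym (*-identityʳ _)) (≤-respʳ-≈ (begin
        ηc * Σr
          ≈⟨ *-cong (*-/-cancel ηc 0<ηd) (*-/-cancel Σr 0<Σa) ⟨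
        (ηd * (ηc / ηd)) * (Σa * (Σr / Σa))
          ≈⟨ solve 4 (λ a b c d → (a :* b) :* (c :* d) := (a :* c) :* (b :* d)) refl ηd (ηc / ηd) Σa (Σr / Σa) ⟩
        (ηd * Σa) * ((ηc / ηd) * (Σr / Σa)) ∎) ηdΣa≤ηcΣr))

      abundant : AbundantInput S m M (input γ)
      abundant = record
        { 0≤a  = demand-nonNeg ∘ phase n
        ; 0≤r  = renewable-nonNeg ∘ phase n
        ; m≤p  = m≤price feasible ∘ phase n
        ; p≤M  = price≤M ∘ phase n
        ; 0<Σa = 0<Σa
        } , 1≤ρ

    -- The two cases for an online algorithm

    agree : ∀ γ γ′ (j : Fin n) → AgreeUpTo (inject₁ (inject₁ j)) (input γ) (input γ′)
    -- Only the crunch demand mentions `γ`; once the phase is known to be `early`, both inputs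
    -- compute to the same data.
    agree γ γ′ j τ τ≤j rewrite phase-early j τ τ≤j = refl , refl , refl

    module _ (A : Algorithm) (online : Online A) (solves : Solves S m M A) where

      -- `Buyable` has `γ = δ` and optimal cost `m * δ`; `Free` has `γ = 0#` and optimal cost zero.
      module Buyable = Offline (proj₁ 0<δ) ≤-refl
      module Free = Offline ≤-refl (proj₁ 0<δ)

      early-bought : Carrier → Fin n → Carrier
      early-bought γ j = bought (A (input γ)) (inject₁ (inject₁ j))

      feasible-δ : Feasible S (input δ) (A (input δ))
      feasible-δ = solves (input δ) Buyable.abundant (_ , Buyable.feasible)

      feasible-0 : Feasible S (input 0#) (A (input 0#))
      feasible-0 = solves (input 0#) Free.abundant (_ , Free.feasible)

      early-bought≈ : sum (early-bought δ) ≈ sum (early-bought 0#)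
      early-bought≈ = sum-cong-≋ λ j →
        let _ , _ , _ , va≈ , vb≈ = online (inject₁ (inject₁ j)) (input δ) (input 0#) (agree δ 0# j)
        in +-cong va≈ vb≈

      -- By `γ≤Σbought` at least `δ` is bought before the flood, and with nothing bought early all
      -- of it falls into the crunch slot, at price `M`.
      idle-case : sum (early-bought δ) ≈ 0# → M * δ ≤ cost (input δ) (A (input δ))
      idle-case idle = ≤-trans Mδ≤payment (≤-trans (last-≤-sum (payment s ∘ inject₁) (payment-nonNeg feasible-δ ∘ inject₁))
        (sum-init-≤ (payment s) (payment-nonNeg feasible-δ (fromℕ (suc n)))))
        where
        s = A (input δ)
        t = inject₁ (fromℕ n)
        δ≤bought : δ ≤ bought s t
        δ≤bought = ≤-respʳ-≈ (trans (sum-init-last (bought s ∘ inject₁)) (trans (+-congʳ idle) (+-identityˡ _)))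
          (γ≤Σbought feasible-δ)
        Mδ≤payment : M * δ ≤ payment s t
        -- For a variable `n` the phase of `t` does not compute; the rewriting turns the price into
        -- `M`.
        Mδ≤payment rewrite phase-crunch n = *-monoʳ-≤ (≤-trans (proj₁ 0<m) m≤M) δ≤bought

      -- Being online, the algorithm makes the same early purchases when the crunch demand is zero,
      -- and each unit costs at least `m`.
      busy-case : ¬ (sum (early-bought δ) ≈ 0#) → 0# < cost (input 0#) (A (input 0#))
      busy-case busy = <-≤-trans (*-pos 0<m 0<bought) (mΣbought≤cost feasible-0)
        where
        s = A (input 0#)
        0<bought : 0# < sum (bought s ∘ inject₁)
        0<bought = <-≤-trans
          (sum-nonNeg (bought-nonNeg feasible-0 ∘ inject₁ ∘ inject₁) , λ 0≈ → busy (trans early-bought≈ (sym 0≈)))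
          (sum-init-≤ (bought s ∘ inject₁) (bought-nonNeg feasible-0 (inject₁ (fromℕ n))))

      competitive-ratio : CR[ S , m , M , A ]≥ (M / m)
      competitive-ratio with sum (early-bought δ) ≟ 0#
      -- The witness is the input with crunch demand `δ`, where the ratio is at least `M * δ` over
      -- `m * δ`.
      ... | yes idle = _ , input δ , Buyable.schedule , Buyable.abundant , Buyable.optimal , inj₁
              ( <-≤-trans (*-pos 0<m 0<δ) (≤-reflexive (sym Buyable.cost≈mγ))
              , x≤y/z (<-≤-trans (*-pos 0<m 0<δ) (≤-reflexive (sym Buyable.cost≈mγ)))
                  (≤-respˡ-≈ (sym cost*φ≈Mδ) (idle-case idle)))
        where
        cost*φ≈Mδ : cost (input δ) Buyable.schedule * (M / m) ≈ M * δ
        cost*φ≈Mδ = begin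
          cost (input δ) Buyable.schedule * (M / m)  ≈⟨ *-congʳ Buyable.cost≈mγ ⟩
          m * δ * (M / m)                            ≈⟨ solve 3 (λ x y z → x :* y :* z := x :* z :* y) refl m δ (M / m) ⟩
          m * (M / m) * δ                            ≈⟨ *-congʳ (*-/-cancel M 0<m) ⟩
          M * δ                                      ∎
      -- Here the optimum is `m * 0#`, so a positive cost makes the ratio unbounded.
      ... | no busy = _ , input 0# , Free.schedule , Free.abundant , Free.optimal , inj₂
              (trans Free.cost≈mγ (zeroʳ m) , busy-case busy)

theorem3 : ∀ {c ℓ₁ ℓ₂} (F : ArchimedeanOrderedField c ℓ₁ ℓ₂) →
    let open ArchimedeanOrderedField F
        open EnergyStorage F
    in (S : System) (m M : Carrier) → 0# < m → m ≤ M →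
       (A : Algorithm) → Online A → Solves S m M A →
       CR[ S , m , M , A ]≥ (M / m)
theorem3 F S m M 0<m m≤M A = competitive-ratio S (parameters S) m M 0<m m≤M A
  where open Adversary F
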